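{- Let $\varphi\in\mathrm{For}(\Sigma)$. If $\nvdash_{\mathrm{RmbC}(\mathrm{a}_\neg)}\varphi$, then there exist a finite BALFI $\mathbf{A}\in\mathsf{BI}(\mathrm{a}_\neg)$ and a valuation $v:\mathrm{For}(\Sigma)\to A$ such that $v(\varphi)\neq 1$.
   Context: $\mathrm{For}(\Sigma)$ is the set of formulas built from a countably infinite set of propositional variables using binary $\wedge,\vee,\to$ and unary $\neg,\circ$; $\alpha\leftrightarrow\beta$ abbreviates $(\alpha\to\beta)\wedge(\beta\to\alpha)$. The logic $\mathrm{RmbC}$ is given by the Hilbert calculus with axiom schemas $\alpha\to(\beta\to\alpha)$; $(\alpha\to(\beta\to\gamma))\to((\alpha\to\beta)\to(\alpha\to\gamma))$; $\alpha\to(\beta\to(\alpha\wedge\beta))$; $(\alpha\wedge\beta)\to\alpha$; $(\alpha\wedge\beta)\to\beta$; $\alpha\to(\alpha\vee\beta)$; $\beta\to(\alpha\vee\beta)$; $(\alpha\to\gamma)\to((\beta\to\gamma)\to((\alpha\vee\beta)\to\gamma))$; $(\alpha\to\beta)\vee\alpha$; $\alpha\vee\neg\alpha$; $\circ\alpha\to(\alpha\to(\neg\alpha\to\beta))$; and inference rules: modus ponens; $(R_\neg)$: from $\alpha\leftrightarrow\psi$ infer $\neg\alpha\leftrightarrow\neg\psi$; $(R_\circ)$: from $\alpha\leftrightarrow\psi$ infer $\circ\alpha\leftrightarrow\circ\psi$. $\mathrm{RmbC}(\mathrm{a}_\neg)$ is obtained by adding the axiom schema $(\mathrm{a}_\neg)$: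 $\circ\alpha\to\circ\neg\alpha$, and $\vdash_{\mathrm{RmbC}(\mathrm{a}_\neg)}\varphi$ means $\varphi$ is derivable in it (without premises). A BALFI is an algebra $\mathbf{B}=\langle B,\wedge,\vee,\to,\neg,\circ,0,1\rangle$ such that $\langle B,\wedge,\vee,\to,0,1\rangle$ is a Boolean algebra and, for every $a\in B$, $a\vee\neg a=1$ and $a\wedge\neg a\wedge\circ a=0$. A valuation over $\mathbf{B}$ is a homomorphism $v:\mathrm{For}(\Sigma)\to B$. $\mathsf{BI}(\mathrm{a}_\neg)$ is the class of BALFIs validating $(\mathrm{a}_\neg)$, equivalently satisfying $\circ a\wedge\circ\neg a=\circ a$ for all $a$. -}

module Defs where

open import Algebra.Core using (Op₁; Op₂)
open import Algebra.Definitions using (Congruent₁)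
open import Algebra.Lattice.Structures using (IsBooleanAlgebra)
open import Data.Fin.Base using (Fin)
open import Data.Nat.Base using (ℕ)
open import Data.Product.Base using (∃)
open import Function.Bundles using (Inverse)
open import Level using (Level; 0ℓ; suc; _⊔_)
open import Relation.Binary.Bundles using (Setoid)
open import Relation.Binary.Core using (Rel)
open import Relation.Binary.PropositionalEquality.Properties using (setoid)
open import Relation.Unary using (Pred; _∈_; _∪_)

private
  variable
    c ℓ : Level

infix  9 ¬ᶠ_ ∘ᶠ_
infixr 7 _∧ᶠ_
infixr 6 _∨ᶠ_
infixr 5 _⇒ᶠ_
infix  4 _⇔ᶠ_

data Formula : Set where
  var  : ℕ → Formula
  _∧ᶠ_ : Formula → Formula → Formula
  _∨ᶠ_ : Formula → Formula → Formula
  _⇒ᶠ_ : Formula → Formula → Formula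
  ¬ᶠ_  : Formula → Formula
  ∘ᶠ_  : Formula → Formula

_⇔ᶠ_ : Formula → Formula → Formula
α ⇔ᶠ β = (α ⇒ᶠ β) ∧ᶠ (β ⇒ᶠ α)

data RmbC : Pred Formula 0ℓ where
  K        : ∀ α β   → RmbC (α ⇒ᶠ (β ⇒ᶠ α))
  S        : ∀ α β γ → RmbC ((α ⇒ᶠ (β ⇒ᶠ γ)) ⇒ᶠ ((α ⇒ᶠ β) ⇒ᶠ (α ⇒ᶠ γ)))
  ∧-intro  : ∀ α β   → RmbC (α ⇒ᶠ (β ⇒ᶠ (α ∧ᶠ β)))
  ∧-elim₁  : ∀ α β   → RmbC ((α ∧ᶠ β) ⇒ᶠ α)
  ∧-elim₂  : ∀ α β   → RmbC ((α ∧ᶠ β) ⇒ᶠ β)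
  ∨-intro₁ : ∀ α β   → RmbC (α ⇒ᶠ (α ∨ᶠ β))
  ∨-intro₂ : ∀ α β   → RmbC (β ⇒ᶠ (α ∨ᶠ β))
  ∨-elim   : ∀ α β γ → RmbC ((α ⇒ᶠ γ) ⇒ᶠ ((β ⇒ᶠ γ) ⇒ᶠ ((α ∨ᶠ β) ⇒ᶠ γ)))
  ⇒-or     : ∀ α β   → RmbC ((α ⇒ᶠ β) ∨ᶠ α)
  ¬-or     : ∀ α     → RmbC (α ∨ᶠ (¬ᶠ α))
  bc       : ∀ α β   → RmbC ((∘ᶠ α) ⇒ᶠ (α ⇒ᶠ ((¬ᶠ α) ⇒ᶠ β)))

data a¬ : Pred Formula 0ℓ where
  a¬-ax : ∀ α → a¬ ((∘ᶠ α) ⇒ᶠ (∘ᶠ (¬ᶠ α)))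

infix 3 _⊢_

-- Premise-free derivability from a set Ax of axioms: the replacement rules
-- apply to theorems only.
data _⊢_ (Ax : Pred Formula 0ℓ) : Pred Formula 0ℓ where
  axiom : ∀ {α} → α ∈ Ax → Ax ⊢ α
  mp    : ∀ {α β} → Ax ⊢ α → Ax ⊢ α ⇒ᶠ β → Ax ⊢ β
  R¬    : ∀ {α ψ} → Ax ⊢ α ⇔ᶠ ψ → Ax ⊢ (¬ᶠ α) ⇔ᶠ (¬ᶠ ψ)
  R∘    : ∀ {α ψ} → Ax ⊢ α ⇔ᶠ ψ → Ax ⊢ (∘ᶠ α) ⇔ᶠ (∘ᶠ ψ)

RmbC[a¬] : Pred Formula 0ℓ
RmbC[a¬] = RmbC ∪ a¬

record BALFI c ℓ : Set (suc (c ⊔ ℓ)) where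
  infix  9 ¬_ ∘_
  infixr 7 _∧_
  infixr 6 _∨_
  infixr 5 _⇒_
  infix  4 _≈_
  field
    Carrier : Set c
    _≈_     : Rel Carrier ℓ
    _∧_     : Op₂ Carrier
    _∨_     : Op₂ Carrier
    _⇒_     : Op₂ Carrier
    ¬_      : Op₁ Carrier
    ∘_      : Op₁ Carrier
    0#      : Carrier
    1#      : Carrier
    -- In the signature ∧, ∨, →, 0, 1 the Boolean complement of a is a → 0;
    -- it is in general different from the paraconsistent ¬ a.
    isBooleanAlgebra : IsBooleanAlgebra _≈_ _∨_ _∧_ (λ a → a ⇒ 0#) 1# 0#
    ⇒-def   : ∀ a b → a ⇒ b ≈ (a ⇒ 0#) ∨ b
    ¬-cong  : Congruent₁ _≈_ ¬_
    ∘-cong  : Congruent₁ _≈_ ∘_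
    ∨-¬     : ∀ a → a ∨ ¬ a ≈ 1#
    ∧-¬-∘   : ∀ a → (a ∧ ¬ a) ∧ ∘ a ≈ 0#

  open IsBooleanAlgebra isBooleanAlgebra public using (isEquivalence)

  ≈-setoid : Setoid c ℓ
  ≈-setoid = record { isEquivalence = isEquivalence }

record Valuation (A : BALFI c ℓ) : Set (c ⊔ ℓ) where
  open BALFI A
  field
    ⟦_⟧    : Formula → Carrier
    ∧-homo : ∀ α β → ⟦ α ∧ᶠ β ⟧ ≈ ⟦ α ⟧ ∧ ⟦ β ⟧
    ∨-homo : ∀ α β → ⟦ α ∨ᶠ β ⟧ ≈ ⟦ α ⟧ ∨ ⟦ β ⟧
    ⇒-homo : ∀ α β → ⟦ α ⇒ᶠ β ⟧ ≈ ⟦ α ⟧ ⇒ ⟦ β ⟧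
    ¬-homo : ∀ α → ⟦ ¬ᶠ α ⟧ ≈ ¬ ⟦ α ⟧
    ∘-homo : ∀ α → ⟦ ∘ᶠ α ⟧ ≈ ∘ ⟦ α ⟧

infix 4 _[_]≈1 _⊨_

_[_]≈1 : {A : BALFI c ℓ} → Valuation A → Formula → Set ℓ
_[_]≈1 {A = A} v φ = Valuation.⟦_⟧ v φ ≈ 1#
  where open BALFI A

_⊨_ : BALFI c ℓ → Formula → Set (c ⊔ ℓ)
A ⊨ φ = (v : Valuation A) → v [ φ ]≈1

BI[a¬] : Pred (BALFI c ℓ) (c ⊔ ℓ)
BI[a¬] A = ∀ φ → φ ∈ a¬ → A ⊨ φ

Finite : Pred (BALFI c ℓ) (c ⊔ ℓ)
Finite A = ∃ λ n → Inverse (BALFI.≈-setoid A) (setoid (Fin n))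

{-# OPTIONS --safe #-}
-- The countermodel is the powerset of a finite set of worlds, a world being a
-- truth assignment to the formulas that occur as atoms.  Let N consist of the
-- subformulas of φ together with their classical negations.  Starting from all
-- worlds (for which validity implies derivability, by Kalmár's argument), keep
-- discarding the worlds that refute a formula obtained by an axiom or a
-- replacement rule from formulas valid at the remaining worlds.  Everything
-- discarded is refuted by a theorem, so validity still implies derivability.
-- In the end ¬ and ∘ are well defined on the truth sets [α] with α ∈ N; on
-- every other set a put ¬ a := the complement of a and ∘ a := 1.  As N is
-- closed under complements, so is the collection of the other sets, and this
-- gives ∘ a ≤ ∘ ¬ a everywhere.
module Submission where

open import Defs
open import Data.Product.Base using (Σ-syntax; _×_)
open import Level using (0ℓ)
open import Relation.Nullary.Negation.Core using (¬_)
open import Relation.Unary using (_∈_)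

open import Algebra.Lattice.Structures using (IsBooleanAlgebra)
open import Data.Bool.Base using (Bool; true; false; not; _∧_; _∨_)
open import Data.Bool.Properties using () renaming (_≟_ to _≟ᵇ_)
open import Data.Empty using (⊥-elim)
open import Data.Fin.Base using (Fin)
open import Data.Fin.Properties using (*↔×; 2↔Bool; 1↔⊤)
open import Data.Fin.Subset using (Subset; ⊤; ⊥; _∪_; _∩_; ∁)
open import Data.Fin.Subset.Properties
  using (∪-∩-isBooleanAlgebra; ∪-∩-booleanAlgebra; ∪-identityʳ; ∪-zeroʳ;
         ∪-inverseˡ; ∪-inverseʳ; ∩-inverseʳ; ∩-zeroˡ)
import Algebra.Lattice.Properties.BooleanAlgebra as BooleanAlgebraProperties
open import Data.List.Base
  using (List; []; _∷_; _++_; map; concat; filter; length; cartesianProductWith)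
open import Data.List.Membership.Propositional using (find; lose)
  renaming (_∈_ to _∈ˡ_)
open import Data.List.Membership.Propositional.Properties
  using (∈-++⁺ˡ; ∈-++⁺ʳ; ∈-++⁻; ∈-map⁺; ∈-map⁻; ∈-filter⁺;
         ∈-cartesianProductWith⁺; ∈-cartesianProductWith⁻)
open import Data.List.Properties using (filter-notAll)
open import Data.List.Relation.Binary.Subset.Propositional using (_⊆_)
open import Data.List.Relation.Unary.All as All using (All; []; _∷_)
open import Data.List.Relation.Unary.All.Properties as AllP
  using (¬Any⇒All¬; ¬All⇒Any¬)
open import Data.List.Relation.Unary.Any using (here; there; any?)
open import Data.Maybe as Maybe using (Maybe; just; nothing; maybe; Is-just)
open import Data.Maybe.Relation.Unary.Any using (just)
open import Data.Nat.Base using (ℕ; zero; suc; _<_; _^_)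
open import Data.Nat.Induction using (Acc; acc; <-wellFounded)
open import Data.Nat.Properties using () renaming (_≟_ to _≟ⁿ_)
open import Data.Product.Base using (∃; _,_; uncurry)
open import Data.Product.Function.NonDependent.Propositional using (_×-↔_)
open import Data.Sum.Base using (inj₁; inj₂)
open import Data.Unit.Base using (tt)
open import Data.Vec.Base as Vec using (Vec; []; _∷_; fromList)
open import Data.Vec.Properties using (≡-dec; ∷-injective; map-const; map-∘)
open import Function.Base using (_∘_; id; _$_)
open import Function.Bundles using (Inverse; _↔_; mk↔ₛ′)
open import Function.Properties.Inverse using (↔-trans; ↔-sym)
open import Relation.Binary.PropositionalEquality
  using (_≡_; refl; sym; trans; cong; cong₂; subst; module ≡-Reasoning)
open import Relation.Binary.Structures using (IsEquivalence)
open import Relation.Nullary.Decidable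
  using (Dec; yes; no; map′; _×-dec_; ¬?; decidable-stable; dec⇒maybe)

infix 3 ⊢_ _⇛_

⊢_ : Formula → Set
⊢ α = RmbC[a¬] ⊢ α

_⇛_ : Formula → Formula → Set
γ ⇛ α = ⊢ γ ⇒ᶠ α

-- Natural deduction

private
  variable
    α β γ δ ψ : Formula

ax : RmbC α → ⊢ α
ax = axiom ∘ inj₁

theorem : ⊢ α → γ ⇛ α
theorem d = mp d (ax (K _ _))

app : γ ⇛ α ⇒ᶠ β → γ ⇛ α → γ ⇛ β
app d e = mp e (mp d (ax (S _ _ _)))

apply : α ⇛ β → γ ⇛ α → γ ⇛ β
apply d = app (theorem d)

-- The context is a single formula, extended by conjunction. The given implication is thus itself a
-- theorem, and the deduction theorem needs no induction over a derivation that may contain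
-- replacement rules.
lam : γ ∧ᶠ α ⇛ β → γ ⇛ α ⇒ᶠ β
lam d = app (apply (ax (S _ _ _)) (apply (ax (K _ _)) (theorem d)))
            (ax (∧-intro _ _))

hyp : γ ∧ᶠ α ⇛ α
hyp = ax (∧-elim₂ _ _)

weaken : γ ⇛ β → γ ∧ᶠ α ⇛ β
weaken d = apply d (ax (∧-elim₁ _ _))

⇛-refl : α ⇛ α
⇛-refl {α} = app (ax (K α (α ⇒ᶠ α))) (ax (K α α))

⇛-trans : α ⇛ β → β ⇛ γ → α ⇛ γ
⇛-trans d e = apply e d

-- A definable falsum: `bc` makes this conjunction explosive. The variable is arbitrary.
⊥ᶠ : Formula
⊥ᶠ = var 0 ∧ᶠ ¬ᶠ var 0 ∧ᶠ ∘ᶠ var 0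

⊥ᶠ-elim : ⊥ᶠ ⇛ α
⊥ᶠ-elim = app (app (apply (ax (bc _ _)) (⇛-trans p₂ (ax (∧-elim₂ _ _))))
                   (ax (∧-elim₁ _ _)))
              (⇛-trans p₂ (ax (∧-elim₁ _ _)))
  where p₂ = ax (∧-elim₂ _ _)

-- The axiom `⇒-or` with `⊥ᶠ` as consequent is excluded middle for classical negation.
by-cases : γ ∧ᶠ α ⇛ ψ → γ ∧ᶠ (α ⇒ᶠ ⊥ᶠ) ⇛ ψ → γ ⇛ ψ
by-cases d e =
  app (app (apply (ax (∨-elim _ _ _)) (lam e)) (lam d)) (theorem (ax (⇒-or _ _)))

-- Worlds and Kalmár's completeness argument

World : Set
World = Formula → Bool

-- Formulas headed by `¬ᶠ` or `∘ᶠ` are opaque atoms. The two operators get constrained only through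
-- the choice of the worlds that are kept.
eval : World → Formula → Bool
eval ρ (α ∧ᶠ β)    = eval ρ α ∧ eval ρ β
eval ρ (α ∨ᶠ β)    = eval ρ α ∨ eval ρ β
eval ρ (α ⇒ᶠ β)    = not (eval ρ α) ∨ eval ρ β
eval ρ α@(var _)   = ρ α
eval ρ α@(¬ᶠ _)    = ρ α
eval ρ α@(∘ᶠ _)    = ρ α

Over : List Formula → Formula → Set
Over L (α ∧ᶠ β)  = Over L α × Over L β
Over L (α ∨ᶠ β)  = Over L α × Over L β
Over L (α ⇒ᶠ β)  = Over L α × Over L β
Over L α@(var _) = α ∈ˡ L
Over L α@(¬ᶠ _)  = α ∈ˡ L
Over L α@(∘ᶠ _)  = α ∈ˡ L

literal : Bool → Formula → Formula
literal true  α = α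
literal false α = α ⇒ᶠ ⊥ᶠ

Decides : Formula → World → List Formula → Set
Decides γ ρ L = ∀ {α} → α ∈ˡ L → γ ⇛ literal (ρ α) α

literal-∧ : ∀ b c → γ ⇛ literal b α → γ ⇛ literal c β →
            γ ⇛ literal (b ∧ c) (α ∧ᶠ β)
literal-∧ true  true  d e = app (apply (ax (∧-intro _ _)) d) e
literal-∧ true  false d e = lam (app (weaken e) (apply (ax (∧-elim₂ _ _)) hyp))
literal-∧ false _     d e = lam (app (weaken d) (apply (ax (∧-elim₁ _ _)) hyp))

literal-∨ : ∀ b c → γ ⇛ literal b α → γ ⇛ literal c β →
            γ ⇛ literal (b ∨ c) (α ∨ᶠ β)
literal-∨ true  _     d e = apply (ax (∨-intro₁ _ _)) d
literal-∨ false true  d e = apply (ax (∨-intro₂ _ _)) e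
literal-∨ false false d e = app (apply (ax (∨-elim _ _ _)) d) e

literal-⇒ : ∀ b c → γ ⇛ literal b α → γ ⇛ literal c β →
            γ ⇛ literal (not b ∨ c) (α ⇒ᶠ β)
literal-⇒ true  true  d e = apply (ax (K _ _)) e
literal-⇒ true  false d e = lam (app (weaken e) (app hyp (weaken d)))
literal-⇒ false _     d e = lam (apply ⊥ᶠ-elim (app (weaken d) hyp))

-- Kalmár's lemma, by induction on the classical structure of the formula.
eval-literal : ∀ {ρ L} α → Over L α → Decides γ ρ L → γ ⇛ literal (eval ρ α) α
eval-literal (var _)  o D = D o
eval-literal (¬ᶠ _)   o D = D o
eval-literal (∘ᶠ _)   o D = D o
eval-literal (α ∧ᶠ β) (o , p) D =
  literal-∧ _ _ (eval-literal α o D) (eval-literal β p D)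
eval-literal (α ∨ᶠ β) (o , p) D =
  literal-∨ _ _ (eval-literal α o D) (eval-literal β p D)
eval-literal (α ⇒ᶠ β) (o , p) D =
  literal-⇒ _ _ (eval-literal α o D) (eval-literal β p D)

infix 4 _≡?_

-- Only positive answers carry a proof, which avoids refuting each pair of distinct connectives.
-- That the diagonal never yields `nothing` is `≡?-refl`.
_≡?_ : (α β : Formula) → Maybe (α ≡ β)
var m    ≡? var n      = Maybe.map (cong var) (dec⇒maybe (m ≟ⁿ n))
α ∧ᶠ β   ≡? α′ ∧ᶠ β′   = Maybe.zipWith (cong₂ _∧ᶠ_) (α ≡? α′) (β ≡? β′)
α ∨ᶠ β   ≡? α′ ∨ᶠ β′   = Maybe.zipWith (cong₂ _∨ᶠ_) (α ≡? α′) (β ≡? β′)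
(α ⇒ᶠ β) ≡? (α′ ⇒ᶠ β′) = Maybe.zipWith (cong₂ _⇒ᶠ_) (α ≡? α′) (β ≡? β′)
¬ᶠ α     ≡? ¬ᶠ α′      = Maybe.map (cong ¬ᶠ_) (α ≡? α′)
∘ᶠ α     ≡? ∘ᶠ α′      = Maybe.map (cong ∘ᶠ_) (α ≡? α′)
_        ≡? _          = nothing

map-is-just : ∀ {A B : Set} {f : A → B} {m} → Is-just m → Is-just (Maybe.map f m)
map-is-just (just _) = just tt

zipWith-is-just : ∀ {A B C : Set} {f : A → B → C} {m n} →
                  Is-just m → Is-just n → Is-just (Maybe.zipWith f m n)
zipWith-is-just (just _) (just _) = just tt

≡?-refl : ∀ α → Is-just (α ≡? α)
≡?-refl (var n) with n ≟ⁿ n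
... | yes _   = just tt
... | no  n≢n = ⊥-elim (n≢n refl)
≡?-refl (α ∧ᶠ β) = zipWith-is-just (≡?-refl α) (≡?-refl β)
≡?-refl (α ∨ᶠ β) = zipWith-is-just (≡?-refl α) (≡?-refl β)
≡?-refl (α ⇒ᶠ β) = zipWith-is-just (≡?-refl α) (≡?-refl β)
≡?-refl (¬ᶠ α)   = map-is-just (≡?-refl α)
≡?-refl (∘ᶠ α)   = map-is-just (≡?-refl α)

assign : Formula → Bool → World → World
assign α b ρ β = maybe (λ _ → b) (ρ β) (α ≡? β)

-- L may contain compound formulas; a world that disagrees with eval on one of
-- them is harmless, since then no consistent γ decides L as the world does.
worlds : List Formula → List World
worlds []      = (λ _ → false) ∷ []
worlds (α ∷ L) = map (assign α true) (worlds L) ++ map (assign α false) (worlds L)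

assign-decides : ∀ b {α ρ L} → Decides γ ρ L →
                 Decides (γ ∧ᶠ literal b α) (assign α b ρ) (α ∷ L)
assign-decides b {α} D (here refl) with α ≡? α | ≡?-refl α
... | just _ | _ = hyp
assign-decides b {α} D {β} (there β∈L) with α ≡? β
-- If `α` recurs in `L`, the new value overrides the old one and the new literal decides it.
... | just refl = hyp
... | nothing   = weaken (D β∈L)

-- Splits by cases on every formula of `L`; `γ` accumulates the chosen literals, so it must stay
-- general in the induction.
worlds-exhaustive : ∀ L →
  (∀ {ρ γ} → ρ ∈ˡ worlds L → Decides γ ρ L → γ ⇛ ψ) → ∀ {γ} → γ ⇛ ψ
worlds-exhaustive []      h = h (here refl) λ ()
worlds-exhaustive (α ∷ L) h = worlds-exhaustive L λ ρ∈ D → by-cases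
  (h (∈-++⁺ˡ (∈-map⁺ _ ρ∈)) (assign-decides true D))
  (h (∈-++⁺ʳ (map (assign α true) (worlds L)) (∈-map⁺ _ ρ∈)) (assign-decides false D))

Valid : List World → Formula → Set
Valid W α = All (λ ρ → eval ρ α ≡ true) W

valid? : ∀ W α → Dec (Valid W α)
valid? W α = All.all? (λ ρ → eval ρ α ≟ᵇ true) W

Complete : List Formula → List World → Set
Complete L W = ∀ {α} → Over L α → Valid W α → ⊢ α

-- Nothing forces eval to make ⊥ᶠ false: its conjuncts are independent atoms.
Consistent : World → Set
Consistent ρ = eval ρ ⊥ᶠ ≡ false

consistent-worlds : List Formula → List World
consistent-worlds L = filter (λ ρ → eval ρ ⊥ᶠ ≟ᵇ false) (worlds L)

consistent-worlds-complete : ∀ {L} → Over L ⊥ᶠ → Complete L (consistent-worlds L)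
consistent-worlds-complete {L} o⊥ {ψ} oψ valid =
  -- Any theorem can serve as the initial context; here it is `ψ ⇒ᶠ ψ`.
  mp (⇛-refl {ψ}) (worlds-exhaustive L derive)
  where
  derive : ∀ {ρ γ} → ρ ∈ˡ worlds L → Decides γ ρ L → γ ⇛ ψ
  derive {ρ} {γ} ρ∈ D with eval ρ ⊥ᶠ in eq
  ... | true  = apply ⊥ᶠ-elim
                  (subst (λ b → γ ⇛ literal b ⊥ᶠ) eq (eval-literal ⊥ᶠ o⊥ D))
  ... | false = subst (λ b → γ ⇛ literal b ψ)
                  (All.lookup valid (∈-filter⁺ _ ρ∈ eq)) (eval-literal ψ oψ D)

-- If `ψ` holds at the surviving worlds, then `α ⇒ᶠ ψ` holds at all of `W`, because the discarded
-- worlds refute `α`. Completeness of `W` and modus ponens do the rest.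
filter-complete : ∀ {L W} → Over L α → ⊢ α → Complete L W →
                  Complete L (filter (λ ρ → eval ρ α ≟ᵇ true) W)
filter-complete {α} {W = W} oα ⊢α complete {ψ} oψ valid =
  mp ⊢α (complete (oα , oψ) (All.tabulate implication))
  where
  implication : ∀ {ρ} → ρ ∈ˡ W → eval ρ (α ⇒ᶠ ψ) ≡ true
  implication {ρ} ρ∈ with eval ρ α in eq
  ... | true  = All.lookup valid (∈-filter⁺ _ ρ∈ eq)
  ... | false = refl

-- Saturation under finitely many rules (premise , conclusion)

Rule : Set
Rule = Formula × Formula

Sound : List Formula → Rule → Set
Sound L (p , c) = Over L p × Over L c × (⊢ p → ⊢ c)

Respects : List World → Rule → Set
Respects W (p , c) = Valid W p → Valid W c

-- A violated rule has a conclusion that fails at some remaining world, so filtering by it shortens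
-- the list. Its premise is valid, hence derivable, so the conclusion is a theorem and completeness
-- survives.
saturate : ∀ {L R} {P : World → Set} → All (Sound L) R →
           ∀ W → Acc _<_ (length W) → Complete L W → All P W →
           Σ[ W′ ∈ List World ] (Complete L W′ × All P W′ × All (Respects W′) R)
saturate {R = R} sound W (acc rec) complete allP
  with any? (λ (p , c) → valid? W p ×-dec ¬? (valid? W c)) R
... | no none = W , complete , allP ,
  All.map (λ {(_ , c)} ¬violated vp →
             decidable-stable (valid? W c) λ ¬vc → ¬violated (vp , ¬vc))
          (¬Any⇒All¬ R none)
... | yes some =
  let (p , c) , r∈R , vp , ¬vc = find some
      op , oc , p⇒c = All.lookup sound r∈R
      c? = λ ρ → eval ρ c ≟ᵇ true
  in saturate sound (filter c? W)
       (rec (filter-notAll c? W (¬All⇒Any¬ c? W ¬vc)))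
       (filter-complete oc (p⇒c (complete op vp)) complete)
       (AllP.filter⁺ c? allP)

-- Truth sets

[_]_ : ∀ {A B : Set} → (A → B) → (W : List A) → Vec B (length W)
[ f ] W = Vec.map f (fromList W)

module _ {A B : Set} {f g : A → B} where

  []-cong : ∀ {W} → All (λ x → f x ≡ g x) W → [ f ] W ≡ [ g ] W
  []-cong []       = refl
  []-cong (p ∷ ps) = cong₂ _∷_ p ([]-cong ps)

  []-injective : ∀ W → [ f ] W ≡ [ g ] W → All (λ x → f x ≡ g x) W
  []-injective []      _  = []
  []-injective (_ ∷ W) eq =
    let p , ps = ∷-injective eq in p ∷ []-injective W ps

  []-zipWith : ∀ {C : Set} (_⊕_ : B → B → C) W →
               [ (λ x → f x ⊕ g x) ] W ≡ Vec.zipWith _⊕_ ([ f ] W) ([ g ] W)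
  []-zipWith _⊕_ []      = refl
  []-zipWith _⊕_ (_ ∷ W) = cong (_ ∷_) ([]-zipWith _⊕_ W)

-- A set of positions in `W` instead of worlds: worlds are functions on all formulas, whereas
-- equality of Boolean vectors is decidable.
truthSet : (W : List World) → Formula → Subset (length W)
truthSet W α = [ (λ ρ → eval ρ α) ] W

module TruthSet (W : List World) where

  private
    e = truthSet W

  ∧-homo : ∀ α β → e (α ∧ᶠ β) ≡ e α ∩ e β
  ∧-homo α β = []-zipWith _∧_ W

  ∨-homo : ∀ α β → e (α ∨ᶠ β) ≡ e α ∪ e β
  ∨-homo α β = []-zipWith _∨_ W

  ⇒-homo : ∀ α β → e (α ⇒ᶠ β) ≡ ∁ (e α) ∪ e β
  ⇒-homo α β = trans ([]-zipWith _∨_ W) (cong (_∪ e β) (map-∘ not _ (fromList W)))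

  valid⇒⊤ : Valid W α → e α ≡ ⊤
  valid⇒⊤ v = trans ([]-cong v) (map-const (fromList W) true)

  ⊤⇒valid : e α ≡ ⊤ → Valid W α
  ⊤⇒valid eq = []-injective W (trans eq (sym (map-const (fromList W) true)))

  consistent⇒⊥ : All Consistent W → e ⊥ᶠ ≡ ⊥
  consistent⇒⊥ c = trans ([]-cong c) (map-const (fromList W) false)

  -- With `≡⇒⇔-valid`, this turns the replacement rules into congruence of operations on truth sets.
  ⇔-valid⇒≡ : Valid W (α ⇔ᶠ β) → e α ≡ e β
  ⇔-valid⇒≡ v = []-cong (All.map (⇔⇒≡ _ _) v)
    where
    ⇔⇒≡ : ∀ b c → (not b ∨ c) ∧ (not c ∨ b) ≡ true → b ≡ c
    ⇔⇒≡ true  true  _ = refl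
    ⇔⇒≡ false false _ = refl
    ⇔⇒≡ true  false ()
    ⇔⇒≡ false true  ()

  ≡⇒⇔-valid : e α ≡ e β → Valid W (α ⇔ᶠ β)
  ≡⇒⇔-valid eq = All.map (≡⇒⇔ _ _) ([]-injective W eq)
    where
    ≡⇒⇔ : ∀ b c → b ≡ c → (not b ∨ c) ∧ (not c ∨ b) ≡ true
    ≡⇒⇔ true  _ refl = refl
    ≡⇒⇔ false _ refl = refl

  ⇒-refl-valid : ∀ α → Valid W (α ⇒ᶠ α)
  ⇒-refl-valid α = ⊤⇒valid {α ⇒ᶠ α} $
    trans (⇒-homo α α) (∪-inverseˡ (e α))

-- Extending partial operations ¬ and ∘ to a finite BALFI

-- `BALFI` takes `a ⇒ 0#` as complement, which here reads `∁ a ∪ ⊥` and must be rewritten to `∁ a`.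
∪⊥-complement-isBooleanAlgebra : ∀ n →
  IsBooleanAlgebra _≡_ _∪_ _∩_ (λ (a : Subset n) → ∁ a ∪ ⊥) ⊤ ⊥
∪⊥-complement-isBooleanAlgebra n = record
  { isDistributiveLattice = isDistributiveLattice
  ; ∨-complement = (λ a → trans (cong (_∪ a) (∪-identityʳ _)) (∨-complementˡ a))
                 , (λ a → trans (cong (a ∪_) (∪-identityʳ _)) (∨-complementʳ a))
  ; ∧-complement = (λ a → trans (cong (_∩ a) (∪-identityʳ _)) (∧-complementˡ a))
                 , (λ a → trans (cong (a ∩_) (∪-identityʳ _)) (∧-complementʳ a))
  ; ¬-cong = cong (λ a → ∁ a ∪ ⊥)
  }
  where
  open IsBooleanAlgebra (∪-∩-isBooleanAlgebra n)
    using (isDistributiveLattice; ∨-complementˡ; ∨-complementʳ;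
           ∧-complementˡ; ∧-complementʳ)

subset↔Fin : ∀ n → Subset n ↔ Fin (2 ^ n)
subset↔Fin zero    = ↔-trans
  (mk↔ₛ′ (λ _ → tt) (λ _ → []) (λ _ → refl) (λ { [] → refl })) (↔-sym 1↔⊤)
subset↔Fin (suc n) = ↔-trans
  (mk↔ₛ′ (λ { (b ∷ a) → b , a }) (uncurry _∷_) (λ _ → refl) (λ { (_ ∷ _) → refl }))
  (↔-trans (↔-sym 2↔Bool ×-↔ subset↔Fin n) (↔-sym *↔×))

∁-involutive : ∀ {n} (a : Subset n) → ∁ (∁ a) ≡ a
∁-involutive = BooleanAlgebraProperties.¬-involutive (∪-∩-booleanAlgebra _)

-- Members of `N` are names: at the element `el i` the operations must take the values `neg i` and
-- `con i`, which the congruence hypotheses make independent of the name. `con-neg` is the law for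
-- `a¬` when `neg i` is itself named.
module Extension
  {I : Set} {n : ℕ} (N : List I) (el neg con : I → Subset n)
  (el-∪-neg   : ∀ {i} → i ∈ˡ N → el i ∪ neg i ≡ ⊤)
  (el-neg-con : ∀ {i} → i ∈ˡ N → (el i ∩ neg i) ∩ con i ≡ ⊥)
  (neg-cong   : ∀ {i j} → i ∈ˡ N → j ∈ˡ N → el i ≡ el j → neg i ≡ neg j)
  (con-cong   : ∀ {i j} → i ∈ˡ N → j ∈ˡ N → el i ≡ el j → con i ≡ con j)
  (con-neg    : ∀ {i j} → i ∈ˡ N → j ∈ˡ N → neg i ≡ el j → ∁ (con i) ∪ con j ≡ ⊤)
  (complement : ∀ {i} → i ∈ˡ N → ∃ λ j → j ∈ˡ N × el j ≡ ∁ (el i))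
  where

  named? : ∀ a → Dec (∃ λ i → i ∈ˡ N × el i ≡ a)
  named? a = map′ find (λ (_ , i∈N , eq) → lose i∈N eq)
                  (any? (λ i → ≡-dec _≟ᵇ_ (el i) a) N)

  neg⁺ : Subset n → Subset n
  neg⁺ a with named? a
  ... | yes (i , _) = neg i
  ... | no  _       = ∁ a

  con⁺ : Subset n → Subset n
  con⁺ a with named? a
  ... | yes (i , _) = con i
  ... | no  _       = ⊤

  neg⁺-el : ∀ {i} → i ∈ˡ N → neg⁺ (el i) ≡ neg i
  neg⁺-el {i} i∈N with named? (el i)
  ... | yes (_ , j∈N , eq) = neg-cong j∈N i∈N eq
  ... | no  unnamed        = ⊥-elim (unnamed (i , i∈N , refl))

  con⁺-el : ∀ {i} → i ∈ˡ N → con⁺ (el i) ≡ con i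
  con⁺-el {i} i∈N with named? (el i)
  ... | yes (_ , j∈N , eq) = con-cong j∈N i∈N eq
  ... | no  unnamed        = ⊥-elim (unnamed (i , i∈N , refl))

  ∪-neg⁺ : ∀ a → a ∪ neg⁺ a ≡ ⊤
  ∪-neg⁺ a with named? a
  ... | yes (_ , i∈N , refl) = el-∪-neg i∈N
  ... | no  _                = ∪-inverseʳ a

  ∩-neg⁺-con⁺ : ∀ a → (a ∩ neg⁺ a) ∩ con⁺ a ≡ ⊥
  ∩-neg⁺-con⁺ a with named? a
  ... | yes (_ , i∈N , refl) = el-neg-con i∈N
  ... | no  _ = trans (cong (_∩ ⊤) (∩-inverseʳ a)) (∩-zeroˡ ⊤)

  -- Where `neg⁺ a` is unnamed, `con⁺` has its default value `⊤` there and the union is `⊤`. Only a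
  -- named `neg⁺ a` needs an argument.
  con⁺-neg⁺ : ∀ a → ∁ (con⁺ a) ∪ con⁺ (neg⁺ a) ≡ ⊤
  con⁺-neg⁺ a with named? a
  con⁺-neg⁺ a | yes (i , i∈N , refl) with named? (neg i)
  ... | yes (_ , j∈N , eq) = con-neg i∈N j∈N (sym eq)
  ... | no  _              = ∪-zeroʳ _
  con⁺-neg⁺ a | no unnamed with named? (∁ a)
  -- A name for `∁ a` would yield one for its complement, which is `a`.
  ... | yes (_ , i∈N , eq) =
        let j , j∈N , eq′ = complement i∈N
        in ⊥-elim (unnamed (j , j∈N , trans eq′ (trans (cong ∁ eq) (∁-involutive a))))
  ... | no  _ = ∪-zeroʳ _

  balfi : BALFI 0ℓ 0ℓ
  balfi = record
    { Carrier = Subset n ; _≈_ = _≡_ ; _∧_ = _∩_ ; _∨_ = _∪_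
    ; _⇒_ = λ a b → ∁ a ∪ b ; ¬_ = neg⁺ ; ∘_ = con⁺ ; 0# = ⊥ ; 1# = ⊤
    ; isBooleanAlgebra = ∪⊥-complement-isBooleanAlgebra n
    ; ⇒-def  = λ a b → cong (_∪ b) (sym (∪-identityʳ _))
    ; ¬-cong = cong neg⁺
    ; ∘-cong = cong con⁺
    ; ∨-¬    = ∪-neg⁺
    ; ∧-¬-∘  = ∩-neg⁺-con⁺
    }

  balfi-finite : Finite balfi
  balfi-finite = _ , record
    { to = to ; from = from ; to-cong = to-cong ; from-cong = from-cong
    ; inverse = inverse }
    where open Inverse (subset↔Fin n)

  balfi-BI[a¬] : balfi ∈ BI[a¬]
  balfi-BI[a¬] _ (a¬-ax α) v = begin
    ⟦ ∘ᶠ α ⇒ᶠ ∘ᶠ ¬ᶠ α ⟧                ≡⟨ ⇒-homo _ _ ⟩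
    ∁ ⟦ ∘ᶠ α ⟧ ∪ ⟦ ∘ᶠ ¬ᶠ α ⟧           ≡⟨ cong₂ (λ a b → ∁ a ∪ b) (∘-homo α)
                                              (trans (∘-homo _) (cong con⁺ (¬-homo α))) ⟩
    ∁ (con⁺ ⟦ α ⟧) ∪ con⁺ (neg⁺ ⟦ α ⟧) ≡⟨ con⁺-neg⁺ ⟦ α ⟧ ⟩
    ⊤                                  ∎
    where
    open Valuation v
    open ≡-Reasoning

-- Valuations determined by their values on variables

module _ {c ℓ} (A : BALFI c ℓ) where
  private module A = BALFI A

  interpret : (ℕ → A.Carrier) → Formula → A.Carrier
  interpret v (var k)  = v k
  interpret v (α ∧ᶠ β) = interpret v α A.∧ interpret v β
  interpret v (α ∨ᶠ β) = interpret v α A.∨ interpret v β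
  interpret v (α ⇒ᶠ β) = interpret v α A.⇒ interpret v β
  interpret v (¬ᶠ α)   = A.¬ interpret v α
  interpret v (∘ᶠ α)   = A.∘ interpret v α

  valuation : (ℕ → A.Carrier) → Valuation A
  valuation v = record
    { ⟦_⟧ = interpret v
    ; ∧-homo = λ _ _ → ≈-refl ; ∨-homo = λ _ _ → ≈-refl ; ⇒-homo = λ _ _ → ≈-refl
    ; ¬-homo = λ _ → ≈-refl ; ∘-homo = λ _ → ≈-refl }
    where open IsEquivalence A.isEquivalence renaming (refl to ≈-refl)

-- The countermodel

sub : Formula → List Formula
sub α@(var _)  = α ∷ []
sub (α ∧ᶠ β)   = α ∧ᶠ β ∷ sub α ++ sub β
sub (α ∨ᶠ β)   = α ∨ᶠ β ∷ sub α ++ sub β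
sub (α ⇒ᶠ β)   = (α ⇒ᶠ β) ∷ sub α ++ sub β
sub (¬ᶠ α)     = ¬ᶠ α ∷ sub α
sub (∘ᶠ α)     = ∘ᶠ α ∷ sub α

sub-self : ∀ α → α ∈ˡ sub α
sub-self (var _)  = here refl
sub-self (_ ∧ᶠ _) = here refl
sub-self (_ ∨ᶠ _) = here refl
sub-self (_ ⇒ᶠ _) = here refl
sub-self (¬ᶠ _)   = here refl
sub-self (∘ᶠ _)   = here refl

sub-trans : ∀ β → α ∈ˡ sub β → sub α ⊆ sub β
sub-trans-++ : ∀ β γ → α ∈ˡ sub β ++ sub γ → sub α ⊆ sub β ++ sub γ

sub-trans (var _)  (here refl) = id
sub-trans (_ ∧ᶠ _) (here refl) = id
sub-trans (_ ∨ᶠ _) (here refl) = id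
sub-trans (_ ⇒ᶠ _) (here refl) = id
sub-trans (¬ᶠ _)   (here refl) = id
sub-trans (∘ᶠ _)   (here refl) = id
sub-trans (β ∧ᶠ γ) (there α∈)  = there ∘ sub-trans-++ β γ α∈
sub-trans (β ∨ᶠ γ) (there α∈)  = there ∘ sub-trans-++ β γ α∈
sub-trans (β ⇒ᶠ γ) (there α∈)  = there ∘ sub-trans-++ β γ α∈
sub-trans (¬ᶠ β)   (there α∈)  = there ∘ sub-trans β α∈
sub-trans (∘ᶠ β)   (there α∈)  = there ∘ sub-trans β α∈

sub-trans-++ β γ α∈ with ∈-++⁻ (sub β) α∈
... | inj₁ α∈β = ∈-++⁺ˡ ∘ sub-trans β α∈β
... | inj₂ α∈γ = ∈-++⁺ʳ (sub β) ∘ sub-trans γ α∈γ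

sub⊆⇒Over : ∀ {L} α → sub α ⊆ L → Over L α
sub⊆⇒Over (var _)  s = s (here refl)
sub⊆⇒Over (¬ᶠ _)   s = s (here refl)
sub⊆⇒Over (∘ᶠ _)   s = s (here refl)
sub⊆⇒Over (α ∧ᶠ β) s = sub⊆⇒Over α (s ∘ there ∘ ∈-++⁺ˡ)
                     , sub⊆⇒Over β (s ∘ there ∘ ∈-++⁺ʳ (sub α))
sub⊆⇒Over (α ∨ᶠ β) s = sub⊆⇒Over α (s ∘ there ∘ ∈-++⁺ˡ)
                     , sub⊆⇒Over β (s ∘ there ∘ ∈-++⁺ʳ (sub α))
sub⊆⇒Over (α ⇒ᶠ β) s = sub⊆⇒Over α (s ∘ there ∘ ∈-++⁺ˡ)
                     , sub⊆⇒Over β (s ∘ there ∘ ∈-++⁺ʳ (sub α))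

module Filtration (φ : Formula) where

  -- The conjunct var 0 puts the atoms of ⊥ᶠ into L.
  Γ N L : List Formula
  Γ = sub (φ ∧ᶠ var 0)
  N = Γ ++ map (_⇒ᶠ ⊥ᶠ) Γ
  L = Γ ++ map ¬ᶠ_ N ++ map ∘ᶠ_ N

  Γ⊆N : Γ ⊆ N
  Γ⊆N = ∈-++⁺ˡ

  φ∈Γ : φ ∈ˡ Γ
  φ∈Γ = there (∈-++⁺ˡ (sub-self φ))

  var0∈Γ : var 0 ∈ˡ Γ
  var0∈Γ = there (∈-++⁺ʳ (sub φ) (here refl))

  ¬∈L : α ∈ˡ N → ¬ᶠ α ∈ˡ L
  ¬∈L = ∈-++⁺ʳ Γ ∘ ∈-++⁺ˡ ∘ ∈-map⁺ ¬ᶠ_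

  ∘∈L : α ∈ˡ N → ∘ᶠ α ∈ˡ L
  ∘∈L = ∈-++⁺ʳ Γ ∘ ∈-++⁺ʳ (map ¬ᶠ_ N) ∘ ∈-map⁺ ∘ᶠ_

  over-Γ : α ∈ˡ Γ → Over L α
  over-Γ α∈Γ = sub⊆⇒Over _ (∈-++⁺ˡ ∘ sub-trans (φ ∧ᶠ var 0) α∈Γ)

  over-⊥ᶠ : Over L ⊥ᶠ
  over-⊥ᶠ = over-Γ var0∈Γ , ¬∈L (Γ⊆N var0∈Γ) , ∘∈L (Γ⊆N var0∈Γ)

  over-N : α ∈ˡ N → Over L α
  over-N α∈N with ∈-++⁻ Γ α∈N
  ... | inj₁ α∈Γ = over-Γ α∈Γ
  ... | inj₂ α∈  with _ , β∈Γ , refl ← ∈-map⁻ (_⇒ᶠ ⊥ᶠ) α∈ = over-Γ β∈Γ , over-⊥ᶠ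

  -- α ⇒ α serves as the premise of the rules that are axioms.
  rulesFor : Formula → Formula → List Rule
  rulesFor α β = (α ⇒ᶠ α        , α ∨ᶠ ¬ᶠ α)
               ∷ (α ⇒ᶠ α        , ∘ᶠ α ⇒ᶠ α ⇒ᶠ ¬ᶠ α ⇒ᶠ ⊥ᶠ)
               ∷ ((α ⇔ᶠ β)      , (¬ᶠ α ⇔ᶠ ¬ᶠ β))
               ∷ ((α ⇔ᶠ β)      , (∘ᶠ α ⇔ᶠ ∘ᶠ β))
               ∷ ((¬ᶠ α ⇔ᶠ β)   , ∘ᶠ α ⇒ᶠ ∘ᶠ β)
               ∷ []

  rulesFor-sound : α ∈ˡ N → β ∈ˡ N → All (Sound L) (rulesFor α β)
  rulesFor-sound {α} {β} α∈N β∈N =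
      ((a , a) , (a , ¬a) , (λ _ → ax (¬-or _)))
    ∷ ((a , a) , (∘a , a , ¬a , over-⊥ᶠ) , (λ _ → ax (bc _ _)))
    ∷ (((a , b) , b , a) , ((¬a , ¬b) , ¬b , ¬a) , R¬)
    ∷ (((a , b) , b , a) , ((∘a , ∘b) , ∘b , ∘a) , R∘)
    -- The formula `∘ᶠ ¬ᶠ α` need not be over `L`, so `a¬` is expressed through a `β` in `N`
    -- equivalent to `¬ᶠ α`; `R∘` passes from `∘ᶠ ¬ᶠ α` to `∘ᶠ β`.
    ∷ (((¬a , b) , b , ¬a) , (∘a , ∘b)
      , λ d → ⇛-trans (axiom (inj₂ (a¬-ax α))) (mp (R∘ d) (ax (∧-elim₁ _ _))))
    ∷ []
    where
    a  = over-N α∈N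
    b  = over-N β∈N
    ¬a = ¬∈L α∈N
    ¬b = ¬∈L β∈N
    ∘a = ∘∈L α∈N
    ∘b = ∘∈L β∈N

  rules : List Rule
  rules = concat (cartesianProductWith rulesFor N N)

  rules-sound : All (Sound L) rules
  rules-sound = AllP.concat⁺ $ All.tabulate λ r∈ →
    let _ , _ , α∈N , β∈N , eq = ∈-cartesianProductWith⁻ rulesFor N N r∈
    in subst (All (Sound L)) (sym eq) (rulesFor-sound α∈N β∈N)

  saturated : Σ[ W ∈ List World ]
    (Complete L W × All Consistent W × All (Respects W) rules)
  saturated = saturate rules-sound (consistent-worlds L) (<-wellFounded _)
    (consistent-worlds-complete over-⊥ᶠ)
    (AllP.all-filter (λ ρ → eval ρ ⊥ᶠ ≟ᵇ false) (worlds L))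

  module Countermodel
    (W : List World) (W-complete : Complete L W) (W-consistent : All Consistent W)
    (W-respects-rules : All (Respects W) rules) where

    W-respects : α ∈ˡ N → β ∈ˡ N → All (Respects W) (rulesFor α β)
    W-respects α∈N β∈N = All.lookup (AllP.concat⁻ W-respects-rules)
                                    (∈-cartesianProductWith⁺ rulesFor α∈N β∈N)

    open TruthSet W

    e : Formula → Subset (length W)
    e = truthSet W

    e-excluded-middle : α ∈ˡ N → e α ∪ e (¬ᶠ α) ≡ ⊤
    e-excluded-middle {α} α∈N with r ∷ _ ← W-respects α∈N α∈N =
      trans (sym (∨-homo α (¬ᶠ α))) (valid⇒⊤ {α ∨ᶠ ¬ᶠ α} (r (⇒-refl-valid α)))

    -- The instance of `bc` with conclusion `⊥ᶠ` is valid in `W`, and every world of `W` makes that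
    -- conclusion false.
    e-∘-explosion : α ∈ˡ N → (e α ∩ e (¬ᶠ α)) ∩ e (∘ᶠ α) ≡ ⊥
    e-∘-explosion {α} α∈N with _ ∷ r ∷ _ ← W-respects α∈N α∈N = begin
      (e α ∩ e (¬ᶠ α)) ∩ e (∘ᶠ α) ≡⟨ cong (_∩ e (∘ᶠ α)) (∧-homo α (¬ᶠ α)) ⟨
      e (α ∧ᶠ ¬ᶠ α) ∩ e (∘ᶠ α)    ≡⟨ ∧-homo (α ∧ᶠ ¬ᶠ α) (∘ᶠ α) ⟨
      e ((α ∧ᶠ ¬ᶠ α) ∧ᶠ ∘ᶠ α)     ≡⟨ []-cong (All.zipWith (uncurry explode-at)
                                               (r (⇒-refl-valid α) , W-consistent)) ⟩
      e ⊥ᶠ                        ≡⟨ consistent⇒⊥ W-consistent ⟩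
      ⊥                           ∎
      where
      open ≡-Reasoning
      explode : ∀ a b c d → not c ∨ (not a ∨ (not b ∨ d)) ≡ true → d ≡ false →
                (a ∧ b) ∧ c ≡ d
      explode false _     _     _ _  refl = refl
      explode true  false _     _ _  refl = refl
      explode true  true  false _ _  refl = refl
      explode true  true  true  _ () refl
      explode-at : ∀ {ρ} → eval ρ (∘ᶠ α ⇒ᶠ α ⇒ᶠ ¬ᶠ α ⇒ᶠ ⊥ᶠ) ≡ true → Consistent ρ →
                   eval ρ ((α ∧ᶠ ¬ᶠ α) ∧ᶠ ∘ᶠ α) ≡ eval ρ ⊥ᶠ
      explode-at {ρ} = explode (eval ρ α) (ρ (¬ᶠ α)) (ρ (∘ᶠ α)) (eval ρ ⊥ᶠ)

    e-¬-cong : α ∈ˡ N → β ∈ˡ N → e α ≡ e β → e (¬ᶠ α) ≡ e (¬ᶠ β)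
    e-¬-cong {α} {β} α∈N β∈N eq with _ ∷ _ ∷ r ∷ _ ← W-respects α∈N β∈N =
      ⇔-valid⇒≡ {¬ᶠ α} {¬ᶠ β} (r (≡⇒⇔-valid {α} {β} eq))

    e-∘-cong : α ∈ˡ N → β ∈ˡ N → e α ≡ e β → e (∘ᶠ α) ≡ e (∘ᶠ β)
    e-∘-cong {α} {β} α∈N β∈N eq with _ ∷ _ ∷ _ ∷ r ∷ _ ← W-respects α∈N β∈N =
      ⇔-valid⇒≡ {∘ᶠ α} {∘ᶠ β} (r (≡⇒⇔-valid {α} {β} eq))

    e-∘-¬ : α ∈ˡ N → β ∈ˡ N → e (¬ᶠ α) ≡ e β → ∁ (e (∘ᶠ α)) ∪ e (∘ᶠ β) ≡ ⊤
    e-∘-¬ {α} {β} α∈N β∈N eq with _ ∷ _ ∷ _ ∷ _ ∷ r ∷ _ ← W-respects α∈N β∈N =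
      trans (sym (⇒-homo (∘ᶠ α) (∘ᶠ β)))
            (valid⇒⊤ {∘ᶠ α ⇒ᶠ ∘ᶠ β} (r (≡⇒⇔-valid {¬ᶠ α} {β} eq)))

    e-classical-¬ : ∀ α → e (α ⇒ᶠ ⊥ᶠ) ≡ ∁ (e α)
    e-classical-¬ α = begin
      e (α ⇒ᶠ ⊥ᶠ)      ≡⟨ ⇒-homo α ⊥ᶠ ⟩
      ∁ (e α) ∪ e ⊥ᶠ   ≡⟨ cong (∁ (e α) ∪_) (consistent⇒⊥ W-consistent) ⟩
      ∁ (e α) ∪ ⊥      ≡⟨ ∪-identityʳ _ ⟩
      ∁ (e α)          ∎
      where open ≡-Reasoning

    -- One layer of classical negations suffices: the complement of the truth set of `β ⇒ᶠ ⊥ᶠ` is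
    -- that of `β`.
    e-complement : α ∈ˡ N → ∃ λ β → β ∈ˡ N × e β ≡ ∁ (e α)
    e-complement {α} α∈N with ∈-++⁻ Γ α∈N
    ... | inj₁ α∈Γ = α ⇒ᶠ ⊥ᶠ , ∈-++⁺ʳ Γ (∈-map⁺ (_⇒ᶠ ⊥ᶠ) α∈Γ) , e-classical-¬ α
    ... | inj₂ α∈  with β , β∈Γ , refl ← ∈-map⁻ (_⇒ᶠ ⊥ᶠ) α∈ =
      β , Γ⊆N β∈Γ , sym (trans (cong ∁ (e-classical-¬ β)) (∁-involutive (e β)))

    open Extension N e (e ∘ ¬ᶠ_) (e ∘ ∘ᶠ_)
      e-excluded-middle e-∘-explosion e-¬-cong e-∘-cong e-∘-¬ e-complement public

    v : Valuation balfi
    v = valuation balfi (e ∘ var)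

    open Valuation v using (⟦_⟧)

    -- The truth lemma. Under `¬ᶠ` and `∘ᶠ` the immediate subformula lies in `N`, so `neg⁺` and
    -- `con⁺` take their prescribed values at its truth set.
    truth : ∀ α → sub α ⊆ N → ⟦ α ⟧ ≡ e α
    truth (var _)  s = refl
    truth (α ∧ᶠ β) s = trans
      (cong₂ _∩_ (truth α (s ∘ there ∘ ∈-++⁺ˡ)) (truth β (s ∘ there ∘ ∈-++⁺ʳ (sub α))))
      (sym (∧-homo α β))
    truth (α ∨ᶠ β) s = trans
      (cong₂ _∪_ (truth α (s ∘ there ∘ ∈-++⁺ˡ)) (truth β (s ∘ there ∘ ∈-++⁺ʳ (sub α))))
      (sym (∨-homo α β))
    truth (α ⇒ᶠ β) s = trans
      (cong₂ (λ a b → ∁ a ∪ b)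
         (truth α (s ∘ there ∘ ∈-++⁺ˡ)) (truth β (s ∘ there ∘ ∈-++⁺ʳ (sub α))))
      (sym (⇒-homo α β))
    truth (¬ᶠ α) s = trans (cong neg⁺ (truth α (s ∘ there))) (neg⁺-el (s (there (sub-self α))))
    truth (∘ᶠ α) s = trans (cong con⁺ (truth α (s ∘ there))) (con⁺-el (s (there (sub-self α))))

    v-complete : v [ φ ]≈1 → ⊢ φ
    v-complete ⟦φ⟧≡⊤ = W-complete (over-Γ φ∈Γ)
      (⊤⇒valid {φ} (trans (sym (truth φ (Γ⊆N ∘ sub-trans (φ ∧ᶠ var 0) φ∈Γ))) ⟦φ⟧≡⊤))

theorem5p10 : (φ : Formula) → ¬ (RmbC[a¬] ⊢ φ) →
    Σ[ A ∈ BALFI 0ℓ 0ℓ ] (Finite A × A ∈ BI[a¬] × (Σ[ v ∈ Valuation A ] ¬ (v [ φ ]≈1)))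
theorem5p10 φ ⊬φ =
  let W , complete , consistent , respects = saturated
      open Countermodel W complete consistent respects
  in balfi , balfi-finite , balfi-BI[a¬] , v , (⊬φ ∘ v-complete)
  where open Filtration φ
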